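{- Let $n\ge 1$ and $1\le k\le n$ be integers. For $f\in\mathrm{RF}_n$, consider the longest sub-path of $P_f$ that contains $v_f$, contains no root vertex, and is such that none of the vertices on the sub-path has a sibling (this sub-path is empty, with $0$ vertices, if no such sub-path exists). Then $f\in\mathrm{RF}_{n,k}$ if and only if the number of vertices on this sub-path is $n-k$.
   Context: Parking functions. A parking function of length $n$ is an $n$-tuple $(a_1,\dots,a_n)$ of positive integers whose weakly increasing rearrangement $b_1\le\dots\le b_n$ satisfies $b_i\le i$ for all $i$; $\mathrm{PF}_n$ is the set of these. For $1<k\le n$, $\mathrm{PF}_{n,k}$ is the set of $a\in\mathrm{PF}_n$ such that $k$ is not an entry of $a$ but each of $k+1,\dots,n$ is an entry of $a$. The remaining elements of $\mathrm{PF}_n$ are the permutations of $(1,\dots,n)$. Forests. A rooted forest is a collection of trees, each with one vertex designated as its root. $\mathrm{RF}_n$ is the set of rooted forests on $n$ vertices whose vertices are labeled bijectively by $\{1,\dots,n\}$. For a vertex $v$, $h(v)$ is the distance from $v$ to the root of its tree; if $v,w$ are adjacent and $h(w)=h(v)+1$, then $v$ is the parent of $w$ and $w$ is a child of $v$. Two distinct vertices are siblings if they have the same parent or are both roots. $\eta(v)=i$ if $v$ has the $i$-th smallest label among the set consisting of $v$ and its siblings. $P_f$ is the unique path in $f$ from a root to a leaf (a vertex with no children) all of whose vertices $v$ satisfy $\eta(v)=1$, and $v_f$ is the leaf at its end. Bijection $\phi:\mathrm{RF}_n\to\mathrm{PF}_n$. Given $f\in\mathrm{RF}_n$, form a labeled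 binary rooted tree $b$ with the same labeled vertices: the root of $b$ is the root of $f$ with $\eta=1$; the left child in $b$ of a vertex $v$ is the sibling $w$ of $v$ in $f$ with $\eta(w)=\eta(v)+1$, if it exists; the right child in $b$ of $v$ is the child $x$ of $v$ in $f$ with $\eta(x)=1$, if it exists. Walk counterclockwise around the outside of $b$ starting at its root: at the first encounter with a vertex record an up step labeled by that vertex; if the vertex has a left child, record a right step when the vertex is encountered for the second time (after going around its left subtree); otherwise record the right step immediately after the up step. (Recursively, the word of a subtree with root $v$, left subtree $L$ and right subtree $R$ is $U_v\,D(L)\,\mathrm{(right)}\,D(R)$, where $D$ of the empty tree is empty.) This gives a labeled Dyck path, and $\phi(f)=(a_1,\dots,a_n)$ where $a_i$ is $1$ plus the number of right steps preceding the up step labeled $i$. The map $\phi$ is a bijection. For $1<k\le n$, $\mathrm{RF}_{n,k}=\phi^{ -1}(\mathrm{PF}_{n,k})$, and $\mathrm{RF}_{n,1}$ is the set of $f\in\mathrm{RF}_n$ such that $\phi(f)$ is a permutation of $(1,\dots,n)$. -}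

module Defs where

open import Data.Fin.Base as Fin using (Fin; toℕ)
open import Data.Fin.Induction using (spo-noetherian)
open import Data.Fin.Permutation using (Permutation′; _⟨$⟩ʳ_)
open import Data.Fin.Properties as Fin using (any?)
open import Data.List.Base using (List; []; _∷_; _++_; length; filter; allFin; head; last)
open import Data.List.Membership.Propositional using (_∈_)
open import Data.List.Relation.Binary.Infix.Heterogeneous using (Infix)
open import Data.List.Relation.Unary.All using (All)
open import Data.List.Relation.Unary.Linked using (Linked)
open import Data.Maybe.Base using (Maybe; just; nothing)
import Data.Maybe.Properties as Maybe
open import Data.Nat.Base using (ℕ; suc; _≤_; _<_)
import Data.Nat.Properties as ℕ
open import Data.Product.Base using (Σ; ∃; ∃-syntax; _×_; _,_)
open import Data.Sum.Base using (_⊎_; inj₁; inj₂)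
open import Function.Base using (flip)
open import Induction.WellFounded using (WellFounded; Acc; acc)
open import Relation.Binary.Definitions using (Transitive; Irreflexive)
open import Relation.Binary.PropositionalEquality
  using (_≡_; _≢_; refl; sym; trans; resp₂; isEquivalence)
open import Relation.Binary.Structures using (IsStrictPartialOrder)
open import Relation.Nullary.Decidable using (Dec; yes; no; _×-dec_; ¬?)
open import Relation.Nullary.Negation using (¬_)
open import Relation.Unary using (Decidable)

-- Throughout, i : Fin n stands for the element suc (toℕ i) of {1,…,n}, both as
-- a vertex label and as a position in an n-tuple.

-- b = a ∘ σ is the weakly increasing rearrangement of a.
IsParkingFunction : ∀ {n} → (Fin n → ℕ) → Set
IsParkingFunction {n} a =
  (∀ i → 1 ≤ a i) ×
  (∃[ σ ] let b : Fin n → ℕ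
              b i = a (σ ⟨$⟩ʳ i)
          in (∀ {i j} → i Fin.≤ j → b i ≤ b j) × (∀ i → b i ≤ suc (toℕ i)))

PF[_] : ∀ {n} → ℕ → (Fin n → ℕ) → Set
PF[_] {n} k a =
  IsParkingFunction a ×
  ¬ (∃[ i ] a i ≡ k) ×
  (∀ j → k < j → j ≤ n → ∃[ i ] a i ≡ j)

IsPermutationOf1⋯n : ∀ {n} → (Fin n → ℕ) → Set
IsPermutationOf1⋯n {n} a = Σ (Permutation′ n) λ σ → ∀ i → a i ≡ suc (toℕ (σ ⟨$⟩ʳ i))

-- A labelled rooted forest is given by its parent map, with nothing at the
-- roots.  The two laws determine height uniquely as the distance to the root;
-- a height function exists exactly when the parent map has no cycles.
record RootedForest (n : ℕ) : Set where
  field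
    parent       : Fin n → Maybe (Fin n)
    height       : Fin n → ℕ
    height-root  : ∀ {v} → parent v ≡ nothing → height v ≡ 0
    height-child : ∀ {v w} → parent w ≡ just v → height w ≡ suc (height v)

data BinaryTree (A : Set) : Set where
  empty : BinaryTree A
  node  : (left : BinaryTree A) (v : A) (right : BinaryTree A) → BinaryTree A

data Step (n : ℕ) : Set where
  up    : Fin n → Step n
  right : Step n

walk : ∀ {n} → BinaryTree (Fin n) → List (Step n)
walk empty        = []
walk (node l v r) = up v ∷ walk l ++ right ∷ walk r

rightsBefore : ∀ {n} → Fin n → List (Step n) → ℕ
rightsBefore i []          = 0
rightsBefore i (right ∷ w) = suc (rightsBefore i w)
rightsBefore i (up j ∷ w) with i Fin.≟ j
... | yes _ = 0
... | no  _ = rightsBefore i w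

graft : ∀ {A B : Set} {P : A → Set} → Dec (∃ P) → (∀ {x} → P x → BinaryTree B) → BinaryTree B
graft (yes (_ , p)) t = t p
graft (no _)        t = empty

module _ {n : ℕ} (f : RootedForest n) where
  open RootedForest f

  IsRoot : Fin n → Set
  IsRoot v = parent v ≡ nothing

  _IsChildOf_ : Fin n → Fin n → Set
  w IsChildOf v = parent w ≡ just v

  IsLeaf : Fin n → Set
  IsLeaf v = ¬ (∃[ w ] w IsChildOf v)

  -- The equation also holds when both parents are nothing, i.e. for two roots.
  Siblings : Fin n → Fin n → Set
  Siblings v w = v ≢ w × parent v ≡ parent w

  _≟ᵖ_ : (p q : Maybe (Fin n)) → Dec (p ≡ q)
  _≟ᵖ_ = Maybe.≡-dec Fin._≟_

  -- The rank of v is the number of labels up to its own among v and its siblings.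
  η : Fin n → ℕ
  η v = length (filter (λ w → (parent w ≟ᵖ parent v) ×-dec (w Fin.≤? v)) (allFin n))

  LeftChild : Fin n → Fin n → Set
  LeftChild v w = Siblings v w × η w ≡ suc (η v)

  RightChild : Fin n → Fin n → Set
  RightChild v x = x IsChildOf v × η x ≡ 1

  FirstRoot : Fin n → Set
  FirstRoot r = IsRoot r × η r ≡ 1

  leftChild? : ∀ v → Decidable (LeftChild v)
  leftChild? v w =
    (¬? (v Fin.≟ w) ×-dec (parent v ≟ᵖ parent w)) ×-dec (η w ℕ.≟ suc (η v))

  rightChild? : ∀ v → Decidable (RightChild v)
  rightChild? v x = (parent x ≟ᵖ just v) ×-dec (η x ℕ.≟ 1)

  firstRoot? : Decidable FirstRoot
  firstRoot? r = (parent r ≟ᵖ nothing) ×-dec (η r ℕ.≟ 1)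

  -- Passing to a child in the binary tree increases (height , η)
  -- lexicographically; this only serves to justify the recursion in treeAt.
  _⊏_ : Fin n → Fin n → Set
  v ⊏ w = height v < height w ⊎ (height v ≡ height w × η v < η w)

  ⊏-irrefl : Irreflexive _≡_ _⊏_
  ⊏-irrefl refl (inj₁ h<)       = ℕ.<-irrefl refl h<
  ⊏-irrefl refl (inj₂ (_ , η<)) = ℕ.<-irrefl refl η<

  ⊏-trans : Transitive _⊏_
  ⊏-trans (inj₁ p)       (inj₁ q)       = inj₁ (ℕ.<-trans p q)
  ⊏-trans (inj₁ p)       (inj₂ (e , _)) = inj₁ (ℕ.<-≤-trans p (ℕ.≤-reflexive e))
  ⊏-trans (inj₂ (e , _)) (inj₁ q)       = inj₁ (ℕ.≤-<-trans (ℕ.≤-reflexive e) q)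
  ⊏-trans (inj₂ (d , p)) (inj₂ (e , q)) = inj₂ (trans d e , ℕ.<-trans p q)

  ⊏-isStrictPartialOrder : IsStrictPartialOrder _≡_ _⊏_
  ⊏-isStrictPartialOrder = record
    { isEquivalence = isEquivalence
    ; irrefl        = ⊏-irrefl
    ; trans         = ⊏-trans
    ; <-resp-≈      = resp₂ _⊏_
    }

  ⊐-wellFounded : WellFounded (flip _⊏_)
  ⊐-wellFounded = spo-noetherian ⊏-isStrictPartialOrder

  siblings-height : ∀ {v w} → parent v ≡ parent w → height v ≡ height w
  siblings-height {v} {w} eq = go (parent w) eq refl
    where
    go : ∀ p → parent v ≡ p → parent w ≡ p → height v ≡ height w
    go nothing  a b = trans (height-root a) (sym (height-root b))
    go (just _) a b = trans (height-child a) (sym (height-child b))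

  left-⊏ : ∀ {v w} → LeftChild v w → v ⊏ w
  left-⊏ ((_ , eq) , ηw) = inj₂ (siblings-height eq , ℕ.≤-reflexive (sym ηw))

  right-⊏ : ∀ {v x} → RightChild v x → v ⊏ x
  right-⊏ (child , _) = inj₁ (ℕ.≤-reflexive (sym (height-child child)))

  treeAt : (v : Fin n) → Acc (flip _⊏_) v → BinaryTree (Fin n)
  treeAt v (acc rs) = node
    (graft (any? (leftChild?  v)) λ {w} p → treeAt w (rs (left-⊏  p)))
    v
    (graft (any? (rightChild? v)) λ {x} p → treeAt x (rs (right-⊏ p)))

  binaryTree : BinaryTree (Fin n)
  binaryTree = graft (any? firstRoot?) λ {r} _ → treeAt r (⊐-wellFounded r)

  φ : Fin n → ℕ
  φ i = suc (rightsBefore i (walk binaryTree))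

  -- p lists the vertices of P_f from the root down to the leaf v_f = v.
  record IsFirstPath (p : List (Fin n)) (v : Fin n) : Set where
    field
      starts : ∃[ r ] head p ≡ just r × IsRoot r
      steps  : Linked (λ x y → y IsChildOf x) p
      ends   : last p ≡ just v × IsLeaf v
      first  : All (λ x → η x ≡ 1) p

  record Admissible (p : List (Fin n)) (v : Fin n) (s : List (Fin n)) : Set where
    field
      subPath    : Infix _≡_ s p
      contains   : v ∈ s
      noRoot     : All (λ x → ¬ IsRoot x) s
      noSiblings : All (λ x → ¬ (∃[ y ] Siblings x y)) s

  IsLongestAdmissible : List (Fin n) → Fin n → List (Fin n) → Set
  IsLongestAdmissible p v s =
    (Admissible p v s × (∀ t → Admissible p v t → length t ≤ length s)) ⊎
    (s ≡ [] × (∀ t → ¬ Admissible p v t))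

  -- For n ≥ 1, P_f exists and is unique, and so is the length of a longest
  -- admissible sub-path (or 0 if there is none): this holds for exactly one m.
  LongestSubPathHasSize : ℕ → Set
  LongestSubPathHasSize m =
    ∃[ p ] ∃[ v ] ∃[ s ] IsFirstPath p v × IsLongestAdmissible p v s × length s ≡ m

RF[_] : ∀ {n} → ℕ → RootedForest n → Set
RF[_] {n} k f =
  (k ≡ 1 × IsPermutationOf1⋯n (φ f)) ⊎
  (1 < k × k ≤ n × PF[ k ] (φ f))

{-# OPTIONS --safe #-}
module Submission where

-- P_f is the right spine v₀, …, vᵣ of the binary tree, so with Lᵢ the left
-- subtree at vᵢ, whose word is D(Lᵢ), the Dyck word is the concatenation of
-- Uᵢ D(Lᵢ) R.  Since η(vᵢ) = 1, Lᵢ is empty exactly when vᵢ has no sibling, and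
-- a nonempty D(Lᵢ) ends with R.  Hence if m is the number of vertices after the
-- last one with a sibling, the word ends with R R (U R)^m: the value k = n − m
-- is skipped between the two adjacent right steps, and each of k + 1, …, n occurs.
-- If no vᵢ has a sibling, the word is (U R)^n, φ(f) is a permutation, and the
-- n − 1 vertices other than the root form the sub-path.

open import Data.Fin.Base as Fin using (Fin; zero; suc; toℕ; fromℕ<; cast)
open import Data.Fin.Induction using (spo-wellFounded)
open import Data.Fin.Permutation as Perm using (Permutation; Permutation′; permutation; ↔⇒≡; cast-id; _∘ₚ_)
open import Data.Fin.Properties as Fin using (any?; toℕ-cast; toℕ-fromℕ<)
open import Data.List.Base using (List; []; _∷_; _++_; length; filter; allFin; tabulate; lookup; last)
open import Data.List.Membership.Propositional using (_∈_; _∉_)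
open import Data.List.Membership.Propositional.Properties using (∈-++⁺ˡ; ∈-++⁺ʳ; ∈-++⁻; ∈-insert; ∈-lookup)
open import Data.List.Properties as List using (∷-injectiveʳ; filter-none; length-++; ++-assoc; ++-identityʳ)
open import Data.List.Relation.Binary.Infix.Heterogeneous using (Infix; MkView; toView; _++ⁱ_; there)
open import Data.List.Relation.Binary.Infix.Heterogeneous.Properties using (fromPointwise)
open import Data.List.Relation.Binary.Pointwise as Pointwise using (Pointwise-≡⇒≡)
open import Data.List.Relation.Unary.All as All using (All; []; _∷_)
open import Data.List.Relation.Unary.All.Properties using (tabulate⁺)
open import Data.List.Relation.Unary.AllPairs using ([]; _∷_)
open import Data.List.Relation.Unary.Any using (here; there; index)
open import Data.List.Relation.Unary.Any.Properties using (lookup-index)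
open import Data.List.Relation.Unary.Linked as Linked using (Linked; []; [-]; _∷_)
open import Data.List.Relation.Unary.Unique.Propositional using (Unique)
open import Data.List.Relation.Unary.Unique.Propositional.Properties using (++⁺)
open import Data.Maybe.Base using (just; nothing)
open import Data.Maybe.Properties using (just-injective)
open import Data.Nat.Base using (ℕ; zero; suc; _+_; _≤_; _<_; _∸_; z≤n; s≤s)
open import Data.Nat.Properties as ℕ using (∸-cancelˡ-≡)
open import Data.Product.Base using (∃; ∃-syntax; _×_; _,_; proj₁; proj₂)
open import Data.Sum.Base using (_⊎_; inj₁; inj₂; [_,_]′)
open import Function.Base using (_∘_; flip)
open import Function.Bundles using (_⇔_; mk⇔)
open import Function.Construct.Composition using (_⇔-∘_)
open import Function.Construct.Symmetry using (⇔-sym)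
open import Induction.WellFounded using (Acc; acc)
open import Relation.Binary.Construct.Closure.ReflexiveTransitive using (Star; ε; _◅_; _◅◅_)
open import Relation.Binary.Definitions using (tri<; tri≈; tri>)
open import Relation.Binary.PropositionalEquality
open import Relation.Nullary.Decidable using (yes; no; _×-dec_; toSum)
open import Relation.Nullary.Negation using (¬_; contradiction)
open import Relation.Unary using (Decidable)
open import Defs

-- Ranks in a decidable subset of `Fin n`.

-- Both filters keep the same positions. This identifies counts over the tail `tabulate suc` of
-- `allFin (suc n)` with counts over `allFin n`, so ranks can be treated by recursion on `n`.
length-filter-tabulate : ∀ {n} {A B : Set} {P : A → Set} {Q : B → Set}
  (P? : Decidable P) (Q? : Decidable Q) (g : Fin n → A) (h : Fin n → B) →
  (∀ i → P (g i) → Q (h i)) → (∀ i → Q (h i) → P (g i)) →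
  length (filter P? (tabulate g)) ≡ length (filter Q? (tabulate h))
length-filter-tabulate {zero} P? Q? g h to from = refl
length-filter-tabulate {suc n} P? Q? g h to from
  with P? (g zero) | Q? (h zero)
     | length-filter-tabulate P? Q? (g ∘ suc) (h ∘ suc) (to ∘ suc) (from ∘ suc)
... | yes _ | yes _ | eq = cong suc eq
... | no  _ | no  _ | eq = eq
... | yes p | no ¬q | _  = contradiction (to zero p) ¬q
... | no ¬p | yes q | _  = contradiction (from zero q) ¬p

-- `η` is the case where `P` means having a given parent. Keeping `P` apart from `v` lets siblings
-- be ranked by one predicate.
rank : ∀ {n} {P : Fin n → Set} → Decidable P → Fin n → ℕ
rank {n} P? v = length (filter (λ w → P? w ×-dec (w Fin.≤? v)) (allFin n))

module _ {n} {P : Fin (suc n) → Set} (P? : Decidable P) where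

  rank-zero : P zero → rank P? zero ≡ 1
  rank-zero p with P? zero
  ... | no ¬p = contradiction p ¬p
  ... | yes _ = cong (suc ∘ length) (filter-none
    (λ w → P? w ×-dec (w Fin.≤? zero {n})) (tabulate⁺ {f = suc} λ { _ (_ , ()) }))

  rank-suc-yes : ∀ v → P zero → rank P? (suc v) ≡ suc (rank (P? ∘ suc) v)
  rank-suc-yes v p with P? zero
  ... | no ¬p = contradiction p ¬p
  ... | yes _ = cong suc (length-filter-tabulate
    (λ w → P? w ×-dec (w Fin.≤? suc v)) (λ w → P? (suc w) ×-dec (w Fin.≤? v)) suc (λ i → i)
    (λ { _ (q , s≤s i≤v) → q , i≤v }) (λ { _ (q , i≤v) → q , s≤s i≤v }))

  rank-suc-no : ∀ v → ¬ P zero → rank P? (suc v) ≡ rank (P? ∘ suc) v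
  rank-suc-no v ¬p with P? zero
  ... | yes p = contradiction p ¬p
  ... | no  _ = length-filter-tabulate
    (λ w → P? w ×-dec (w Fin.≤? suc v)) (λ w → P? (suc w) ×-dec (w Fin.≤? v)) suc (λ i → i)
    (λ { _ (q , s≤s i≤v) → q , i≤v }) (λ { _ (q , i≤v) → q , s≤s i≤v })

rank≢0 : ∀ {n} {P : Fin n → Set} (P? : Decidable P) v → P v → rank P? v ≢ 0
rank≢0 P? zero p eq = contradiction (trans (sym (rank-zero P? p)) eq) λ ()
rank≢0 P? (suc v) p eq with toSum (P? zero)
... | inj₁ p₀ = contradiction (trans (sym (rank-suc-yes P? v p₀)) eq) λ ()
... | inj₂ ¬p₀ = rank≢0 (P? ∘ suc) v p (trans (sym (rank-suc-no P? v ¬p₀)) eq)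

rank-zero≢rank-suc : ∀ {n} {P : Fin (suc n) → Set} (P? : Decidable P) v →
  P zero → P (suc v) → rank P? zero ≢ rank P? (suc v)
rank-zero≢rank-suc P? v p₀ p eq = rank≢0 (P? ∘ suc) v p (ℕ.suc-injective
  (trans (sym (rank-suc-yes P? v p₀)) (trans (sym eq) (rank-zero P? p₀))))

-- Dropping `zero` lowers both ranks by the same amount; if `zero` satisfies `P`, it alone has rank
-- 1.
rank-injective : ∀ {n} {P : Fin n → Set} (P? : Decidable P) {v w} →
  P v → P w → rank P? v ≡ rank P? w → v ≡ w
rank-injective P? {zero}  {zero}  p q eq = refl
rank-injective P? {zero}  {suc w} p q eq = contradiction eq (rank-zero≢rank-suc P? w p q)
rank-injective P? {suc v} {zero}  p q eq = contradiction (sym eq) (rank-zero≢rank-suc P? v q p)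
rank-injective P? {suc v} {suc w} p q eq with toSum (P? zero)
... | inj₁ p₀ = cong suc (rank-injective (P? ∘ suc) p q (ℕ.suc-injective
  (trans (sym (rank-suc-yes P? v p₀)) (trans eq (rank-suc-yes P? w p₀)))))
... | inj₂ ¬p₀ = cong suc (rank-injective (P? ∘ suc) p q
  (trans (sym (rank-suc-no P? v ¬p₀)) (trans eq (rank-suc-no P? w ¬p₀))))

rank-pred : ∀ {n} {P : Fin n → Set} (P? : Decidable P) v {m} →
  P v → rank P? v ≡ suc (suc m) → ∃[ w ] P w × rank P? w ≡ suc m
rank-pred P? zero p eq = contradiction (trans (sym (rank-zero P? p)) eq) λ ()
rank-pred P? (suc v) {m} p eq with toSum (P? zero)
-- The rank of `suc v` is 2 here and `zero` has rank 1, so `zero` is the predecessor.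
rank-pred P? (suc v) {zero}  p eq | inj₁ p₀ = zero , p₀ , rank-zero P? p₀
rank-pred P? (suc v) {suc m} p eq | inj₁ p₀ =
  let w , q , eq′ = rank-pred (P? ∘ suc) v p
                      (ℕ.suc-injective (trans (sym (rank-suc-yes P? v p₀)) eq))
  in suc w , q , trans (rank-suc-yes P? w p₀) (cong suc eq′)
rank-pred P? (suc v) {m} p eq | inj₂ ¬p₀ =
  let w , q , eq′ = rank-pred (P? ∘ suc) v p (trans (sym (rank-suc-no P? v ¬p₀)) eq)
  in suc w , q , trans (rank-suc-no P? w ¬p₀) eq′

-- Duplicate-free lists, infixes and last elements.

Unique-++⇒∉ : ∀ {A : Set} {x : A} xs {ys} → Unique (xs ++ ys) → x ∈ ys → x ∉ xs
Unique-++⇒∉ (y ∷ xs) (y∉ ∷ _)   x∈ys (here refl)  = All.lookup y∉ (∈-++⁺ʳ xs x∈ys) refl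
Unique-++⇒∉ (y ∷ xs) (_ ∷ uniq) x∈ys (there x∈xs) = Unique-++⇒∉ xs uniq x∈ys x∈xs

index-lookup : ∀ {A : Set} {xs : List A} → Unique xs →
  ∀ i (p : lookup xs i ∈ xs) → index p ≡ i
index-lookup (_ ∷ _)    zero    (here _)  = refl
index-lookup (x∉ ∷ _)   zero    (there p) = contradiction refl (All.lookup x∉ p)
index-lookup (x∉ ∷ _)   (suc i) (here eq) = contradiction (sym eq) (All.lookup x∉ (∈-lookup i))
index-lookup (_ ∷ uniq) (suc i) (there p) = cong suc (index-lookup uniq i p)

-- The bijection between positions and labels supplies the sorting permutation of a parking function
-- and, inverted, the permutation read off a `chain`.
module Enumeration {n} {us : List (Fin n)} (uniq : Unique us) (complete : ∀ i → i ∈ us) where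

  private
    lookup-permutation : Permutation (length us) n
    lookup-permutation = permutation (lookup us) (index ∘ complete)
      (λ i → sym (lookup-index (complete i)))
      (λ i → index-lookup uniq i (complete (lookup us i)))

  length≡ : length us ≡ n
  length≡ = ↔⇒≡ lookup-permutation

  enumeration : Permutation′ n
  enumeration = cast-id (sym length≡) ∘ₚ lookup-permutation

infix-split : ∀ {A : Set} {xs ys : List A} → Infix _≡_ xs ys →
  ∃[ pre ] ∃[ rest ] ys ≡ pre ++ xs ++ rest
infix-split inf with MkView pre eqs rest ← toView inf
  with refl ← Pointwise-≡⇒≡ eqs = pre , rest , refl

-- The displayed `x` lies outside `t`, hence inside `pre`, so `t` is a suffix of `us`.
suffix-length : ∀ {A : Set} pre q {t us} {x : A} →
  pre ++ t ≡ q ++ x ∷ us → x ∉ t → length t ≤ length us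
suffix-length []        q  refl x∉ = contradiction (∈-insert q) x∉
-- Now `x` heads the prefix, and `us` is `pre ++ t`.
suffix-length (_ ∷ pre) [] {t} refl x∉ =
  ℕ.≤-trans (ℕ.m≤n+m (length t) (length pre)) (ℕ.≤-reflexive (sym (length-++ pre)))
suffix-length (_ ∷ pre) (_ ∷ q) eq x∉ = suffix-length pre q (∷-injectiveʳ eq) x∉

last-∈ : ∀ {A : Set} (xs : List A) {v} → last xs ≡ just v → v ∈ xs
last-∈ (x ∷ [])     refl = here refl
last-∈ (x ∷ y ∷ xs) eq   = there (last-∈ (y ∷ xs) eq)

last-++ : ∀ {A : Set} q {x y : A} {ys} → last (q ++ x ∷ y ∷ ys) ≡ last (y ∷ ys)
last-++ []          = refl
last-++ (z ∷ [])    = refl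
last-++ (z ∷ w ∷ q) = last-++ (w ∷ q)

-- Step words and the tuples they define.

module _ {n : ℕ} where

  labels : List (Step n) → List (Fin n)
  labels []          = []
  labels (up i ∷ w)  = i ∷ labels w
  labels (right ∷ w) = labels w

  rights : List (Step n) → ℕ
  rights []          = 0
  rights (up _ ∷ w)  = rights w
  rights (right ∷ w) = suc (rights w)

  labels-++ : ∀ w w′ → labels (w ++ w′) ≡ labels w ++ labels w′
  labels-++ []          w′ = refl
  labels-++ (up i ∷ w)  w′ = cong (i ∷_) (labels-++ w w′)
  labels-++ (right ∷ w) w′ = labels-++ w w′

  rights-++ : ∀ w w′ → rights (w ++ w′) ≡ rights w + rights w′
  rights-++ []          w′ = refl
  rights-++ (up i ∷ w)  w′ = rights-++ w w′
  rights-++ (right ∷ w) w′ = cong suc (rights-++ w w′)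

  -- The index is the surplus of up steps over right steps so far; it must never become negative,
  -- but may end at any value.
  data Ballot : ℕ → List (Step n) → Set where
    []    : ∀ {d} → Ballot d []
    up    : ∀ {d i w} → Ballot (suc d) w → Ballot d (up i ∷ w)
    right : ∀ {d w} → Ballot d w → Ballot (suc d) (right ∷ w)

  rightsBefore-self : ∀ (i : Fin n) w → rightsBefore i (up i ∷ w) ≡ 0
  rightsBefore-self i w with i Fin.≟ i
  ... | yes _  = refl
  ... | no i≢i = contradiction refl i≢i

  rightsBefore-other : ∀ {i j : Fin n} w → i ≢ j → rightsBefore i (up j ∷ w) ≡ rightsBefore i w
  rightsBefore-other {i} {j} w i≢j with i Fin.≟ j
  ... | yes i≡j = contradiction i≡j i≢j
  ... | no _    = refl

  rightsBefore-lookup-suc : ∀ {j} w → Unique (j ∷ labels w) → ∀ i →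
    rightsBefore (lookup (labels w) i) (up j ∷ w) ≡ rightsBefore (lookup (labels w) i) w
  rightsBefore-lookup-suc w (j∉ ∷ _) i =
    rightsBefore-other w (All.lookup j∉ (∈-lookup i) ∘ sym)

  -- Right steps only accumulate along the word, so listing labels in walk order sorts the tuple.
  rightsBefore-mono : ∀ w → Unique (labels w) → ∀ i j → i Fin.≤ j →
    rightsBefore (lookup (labels w) i) w ≤ rightsBefore (lookup (labels w) j) w
  rightsBefore-mono (right ∷ w) uniq i j i≤j = s≤s (rightsBefore-mono w uniq i j i≤j)
  rightsBefore-mono (up x ∷ w) uniq zero j i≤j =
    ℕ.≤-trans (ℕ.≤-reflexive (rightsBefore-self x w)) z≤n
  rightsBefore-mono (up x ∷ w) uniq@(_ ∷ uniq′) (suc i) (suc j) (s≤s i≤j) =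
    subst₂ _≤_ (sym (rightsBefore-lookup-suc w uniq i)) (sym (rightsBefore-lookup-suc w uniq j))
      (rightsBefore-mono w uniq′ i j i≤j)

  -- The up step at index `i` has `i` up steps before it, which with the initial surplus `d` bound
  -- the right steps before it.
  rightsBefore-bound : ∀ {d} w → Ballot d w → Unique (labels w) → ∀ i →
    rightsBefore (lookup (labels w) i) w ≤ d + toℕ i
  rightsBefore-bound (right ∷ w) (right b) uniq i = s≤s (rightsBefore-bound w b uniq i)
  rightsBefore-bound {d} (up x ∷ w) (up b) uniq zero =
    ℕ.≤-trans (ℕ.≤-reflexive (rightsBefore-self x w)) z≤n
  rightsBefore-bound {d} (up x ∷ w) (up b) uniq@(_ ∷ uniq′) (suc i) =
    subst₂ _≤_ (sym (rightsBefore-lookup-suc w uniq i)) (sym (ℕ.+-suc d (toℕ i)))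
      (rightsBefore-bound w b uniq′ i)

  rightsBefore-++ : ∀ (i : Fin n) w w′ → i ∉ labels w →
    rightsBefore i (w ++ w′) ≡ rights w + rightsBefore i w′
  rightsBefore-++ i []          w′ i∉ = refl
  rightsBefore-++ i (right ∷ w) w′ i∉ = cong suc (rightsBefore-++ i w w′ i∉)
  rightsBefore-++ i (up j ∷ w)  w′ i∉ =
    begin
      rightsBefore i (up j ∷ w ++ w′)   ≡⟨ rightsBefore-other (w ++ w′) (i∉ ∘ here) ⟩
      rightsBefore i (w ++ w′)          ≡⟨ rightsBefore-++ i w w′ (i∉ ∘ there) ⟩
      rights w + rightsBefore i w′      ∎
    where open ≡-Reasoning

  -- A label in `w` has at most `rights w` right steps before it, any other at least two more: no up
  -- step stands between the two adjacent right steps.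
  rightsBefore-gap : ∀ (i : Fin n) w w′ → rightsBefore i (w ++ right ∷ right ∷ w′) ≢ suc (rights w)
  rightsBefore-gap i [] w′ ()
  rightsBefore-gap i (right ∷ w) w′ eq = rightsBefore-gap i w w′ (ℕ.suc-injective eq)
  rightsBefore-gap i (up j ∷ w)  w′ eq with i Fin.≟ j
  ... | yes _ = contradiction eq λ ()
  ... | no  _ = rightsBefore-gap i w w′ eq

  -- The word of a right spine whose vertices have no left children.
  chain : List (Fin n) → List (Step n)
  chain []       = []
  chain (u ∷ us) = up u ∷ right ∷ chain us

  labels-chain : ∀ us → labels (chain us) ≡ us
  labels-chain []       = refl
  labels-chain (u ∷ us) = cong (u ∷_) (labels-chain us)

  rights-chain : ∀ us → rights (chain us) ≡ length us
  rights-chain []       = refl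
  rights-chain (u ∷ us) = cong suc (rights-chain us)

  rightsBefore-chain : ∀ us → Unique us → ∀ i → rightsBefore (lookup us i) (chain us) ≡ toℕ i
  rightsBefore-chain (u ∷ us) uniq zero = rightsBefore-self u (right ∷ chain us)
  rightsBefore-chain (u ∷ us) (u∉ ∷ uniq) (suc i) =
    trans (rightsBefore-other {lookup us i} {u} (right ∷ chain us) (All.lookup u∉ (∈-lookup i) ∘ sym))
          (cong suc (rightsBefore-chain us uniq i))

  tuple : List (Step n) → Fin n → ℕ
  tuple w i = suc (rightsBefore i w)

  tuple-isParkingFunction : ∀ {w} → Ballot 0 w → Unique (labels w) →
    (∀ i → i ∈ labels w) → IsParkingFunction (tuple w)
  tuple-isParkingFunction {w} ballot uniq complete =
    (λ _ → s≤s z≤n) , enumeration ,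
    (λ {i} {j} i≤j → s≤s (rightsBefore-mono w uniq (cast _ i) (cast _ j)
       (subst₂ _≤_ (sym (toℕ-cast (sym length≡) i)) (sym (toℕ-cast (sym length≡) j)) i≤j))) ,
    (λ i → s≤s (ℕ.≤-trans (rightsBefore-bound w ballot uniq (cast _ i))
                          (ℕ.≤-reflexive (toℕ-cast (sym length≡) i))))
    where open Enumeration uniq complete

  tuple-chain-isPermutation : ∀ {us} → Unique us → (∀ i → i ∈ us) →
    IsPermutationOf1⋯n (tuple (chain us))
  -- A label goes to its position in `us`, which is the inverse of `enumeration`.
  tuple-chain-isPermutation {us} uniq complete = Perm.flip enumeration , λ i →
    cong suc (trans (cong (λ v → rightsBefore v (chain us)) (lookup-index (complete i)))
             (trans (rightsBefore-chain us uniq (index (complete i)))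
                    (sym (toℕ-cast length≡ (index (complete i))))))
    where open Enumeration uniq complete

  tuple-tail : ∀ w us → Unique (labels w ++ us) → ∀ j →
    2 + rights w < j → j ≤ 2 + rights w + length us →
    ∃[ i ] tuple (w ++ right ∷ right ∷ chain us) i ≡ j
  tuple-tail w us uniq j lo hi
    -- Here `j` is `3 + rights w + x`, attained at the vertex with index `x` in `us`.
    with x , refl ← ℕ.m≤n⇒∃[o]m+o≡n lo = lookup us y , cong suc (begin
      rightsBefore (lookup us y) (w ++ right ∷ right ∷ chain us)
        ≡⟨ rightsBefore-++ _ w _ (Unique-++⇒∉ (labels w) uniq (∈-lookup y)) ⟩
      rights w + (2 + rightsBefore (lookup us y) (chain us))
        ≡⟨ cong (λ z → rights w + (2 + z)) (rightsBefore-chain us (Unique-++ʳ (labels w) uniq) y) ⟩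
      rights w + (2 + toℕ y)
        ≡⟨ cong (λ z → rights w + (2 + z)) (toℕ-fromℕ< x<) ⟩
      rights w + (2 + x)
        ≡⟨ ℕ.+-suc (rights w) (suc x) ⟩
      suc (rights w + suc x)
        ≡⟨ cong suc (ℕ.+-suc (rights w) x) ⟩
      2 + rights w + x ∎)
    where
    open ≡-Reasoning
    x< : x < length us
    x< = ℕ.+-cancelˡ-≤ (2 + rights w) _ _
           (subst (_≤ 2 + rights w + length us) (sym (ℕ.+-suc (2 + rights w) x)) hi)
    y = fromℕ< x<
    Unique-++ʳ : ∀ {A : Set} (xs : List A) {ys} → Unique (xs ++ ys) → Unique ys
    Unique-++ʳ []       u       = u
    Unique-++ʳ (_ ∷ xs) (_ ∷ u) = Unique-++ʳ xs u

  -- The index of the class of a tuple.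

  -- `RF[ k ] f` unfolds to `Class k (φ f)`; this form applies to arbitrary tuples.
  Class : ℕ → (Fin n → ℕ) → Set
  Class k a = (k ≡ 1 × IsPermutationOf1⋯n a) ⊎ (1 < k × k ≤ n × PF[ k ] a)

  permutation-onto : ∀ {a} → IsPermutationOf1⋯n a → ∀ j → 1 ≤ j → j ≤ n → ∃[ i ] a i ≡ j
  permutation-onto (σ , eq) (suc j) _ j<n = σ Perm.⟨$⟩ˡ fromℕ< j<n ,
    trans (eq _) (cong suc (trans (cong toℕ (Perm.inverseʳ σ)) (toℕ-fromℕ< j<n)))

  Class-permutation : ∀ {a k} → IsPermutationOf1⋯n a → Class k a ⇔ k ≡ 1
  Class-permutation {a} {k} perm = mk⇔
    (λ { (inj₁ (k≡1 , _)) → k≡1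
       ; (inj₂ (1<k , k≤n , _ , missing , _)) →
           contradiction (permutation-onto perm k (ℕ.<⇒≤ 1<k) k≤n) missing })
    (λ k≡1 → inj₁ (k≡1 , perm))

  -- The index is the largest value in 1, ..., n that `a` misses, so `a` determines it; a
  -- permutation misses none.
  Class-missing : ∀ {a k k₀} → 1 < k₀ → k₀ ≤ n → PF[ k₀ ] a → Class k a ⇔ k ≡ k₀
  Class-missing {a} {k} {k₀} 1<k₀ k₀≤n pf@(_ , missing₀ , present₀) = mk⇔ to
    (λ { refl → inj₂ (1<k₀ , k₀≤n , pf) })
    where
    to : Class k a → k ≡ k₀
    to (inj₁ (_ , perm)) = contradiction (permutation-onto perm k₀ (ℕ.<⇒≤ 1<k₀) k₀≤n) missing₀
    to (inj₂ (_ , k≤n , _ , missing , present)) with ℕ.<-cmp k k₀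
    ... | tri< k<k₀ _ _ = contradiction (present k₀ k<k₀ k₀≤n) missing₀
    ... | tri≈ _ eq _   = eq
    ... | tri> _ _ k₀<k = contradiction (present₀ k k₀<k k≤n) missing

  -- Words of binary trees.

  rights-walk : ∀ t → rights (walk {n} t) ≡ length (labels (walk t))
  rights-walk empty = refl
  rights-walk (node l v r) = begin
    rights (walk l ++ right ∷ walk r)              ≡⟨ rights-++ (walk l) _ ⟩
    rights (walk l) + suc (rights (walk r))        ≡⟨ ℕ.+-suc (rights (walk l)) _ ⟩
    suc (rights (walk l) + rights (walk r))        ≡⟨ cong suc (cong₂ _+_ (rights-walk l) (rights-walk r)) ⟩
    suc (length (labels (walk l)) + length (labels (walk r)))
      ≡⟨ cong suc (length-++ (labels (walk l))) ⟨
    suc (length (labels (walk l) ++ labels (walk r)))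
      ≡⟨ cong (suc ∘ length) (labels-++ (walk l) _) ⟨
    suc (length (labels (walk l ++ right ∷ walk r))) ∎
    where open ≡-Reasoning

  -- The word of a tree returns to its initial surplus, so a continuation `w` resumes at the same
  -- `d`; carrying `w` makes the induction go through.
  walk-ballot : ∀ {d} t {w} → Ballot d w → Ballot d (walk t ++ w)
  walk-ballot empty b = b
  walk-ballot (node l v r) {w} b = up (subst (Ballot _) (sym (++-assoc (walk l) (right ∷ walk r) w))
    (walk-ballot l (right (walk-ballot r b))))

  -- For a nonempty left subtree, this final right step and that of its parent vertex form the
  -- adjacent pair.
  walk-ends-right : ∀ l v r → ∃[ w ] walk {n} (node l v r) ≡ w ++ right ∷ []
  walk-ends-right l v empty           = up v ∷ walk l , refl
  walk-ends-right l v (node l′ v′ r′) =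
    let w , eq = walk-ends-right l′ v′ r′
    in up v ∷ walk l ++ right ∷ w ,
       cong (up v ∷_) (trans (cong (λ z → walk l ++ right ∷ z) eq)
                             (sym (++-assoc (walk l) (right ∷ w) _)))

-- Ranks of siblings in the forest.

module _ {n} (f : RootedForest n) where
  open RootedForest f

  private
    sameParent? : ∀ p → Decidable (λ w → parent w ≡ p)
    sameParent? p w = _≟ᵖ_ f (parent w) p

  η-rank : ∀ {v p} → parent v ≡ p → η f v ≡ rank (sameParent? p) v
  η-rank refl = refl

  η-injective : ∀ {v w} → parent v ≡ parent w → η f v ≡ η f w → v ≡ w
  η-injective same eq = rank-injective (sameParent? _) same refl (trans (sym (η-rank same)) eq)

  η≢0 : ∀ v → η f v ≢ 0
  η≢0 v = rank≢0 (sameParent? (parent v)) v refl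

  η-pred : ∀ v {m} → η f v ≡ suc (suc m) → ∃[ w ] parent w ≡ parent v × η f w ≡ suc m
  η-pred v eq =
    let w , same , eq′ = rank-pred (sameParent? (parent v)) v refl eq
    in w , same , trans (η-rank same) eq′

  sibling-of-rank : ∀ v m d → η f v ≡ d + suc m → ∃[ w ] parent w ≡ parent v × η f w ≡ suc m
  sibling-of-rank v m zero eq = v , refl , eq
  sibling-of-rank v m (suc d) eq =
    let u , same , eq₁  = η-pred v (trans eq (cong suc (ℕ.+-suc d m)))
        w , same′ , eq₂ = sibling-of-rank u m d (trans eq₁ (sym (ℕ.+-suc d m)))
    in w , trans same′ same , eq₂

  first-sibling : ∀ v → ∃[ w ] parent w ≡ parent v × η f w ≡ 1
  first-sibling v with η f v in eq
  ... | zero  = contradiction eq (η≢0 v)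
  ... | suc d = sibling-of-rank v 0 d (trans eq (sym (ℕ.+-comm d 1)))

  HasSibling : Fin n → Set
  HasSibling v = ∃[ w ] Siblings f v w

  -- A sibling cannot also have rank 1, so its rank is at least 2; descending through the ranks from
  -- it meets rank 2, which is a left child of `v`.
  first-without-next : ∀ {v} → η f v ≡ 1 → ¬ ∃ (LeftChild f v) → ¬ HasSibling v
  first-without-next {v} first none (y , v≢y , same) with η f y in eq
  ... | zero        = η≢0 y eq
  ... | suc zero    = v≢y (η-injective same (trans first (sym eq)))
  ... | suc (suc d) =
    let w , same′ , second = sibling-of-rank y 1 d (trans eq (sym (ℕ.+-comm d 2)))
    in none (w , ((λ { refl → contradiction (trans (sym first) second) λ () })
                 , trans same (sym same′)) , trans second (cong suc (sym first)))

  -- Edges and descendants in the binary tree.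

  BinaryChild : Fin n → Fin n → Set
  BinaryChild v x = LeftChild f v x ⊎ RightChild f v x

  BinaryChild-⊏ : ∀ {v x} → BinaryChild v x → _⊏_ f v x
  BinaryChild-⊏ = [ left-⊏ f , right-⊏ f ]′

  -- Left children have rank at least 2, right children rank 1.
  left≢right : ∀ {u v x} → LeftChild f u x → ¬ RightChild f v x
  left≢right {u} (_ , ηx) (_ , first) = η≢0 u (ℕ.suc-injective (trans (sym ηx) first))

  BinaryChild-injective : ∀ {u v x} → BinaryChild u x → BinaryChild v x → u ≡ v
  BinaryChild-injective (inj₁ ((_ , s) , e)) (inj₁ ((_ , s′) , e′)) =
    η-injective (trans s (sym s′)) (ℕ.suc-injective (trans (sym e) e′))
  BinaryChild-injective (inj₁ l) (inj₂ r) = contradiction r (left≢right l)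
  BinaryChild-injective (inj₂ r) (inj₁ l) = contradiction r (left≢right l)
  BinaryChild-injective (inj₂ (c , _)) (inj₂ (c′ , _)) = just-injective (trans (sym c) c′)

  LeftChild-functional : ∀ {v x y} → LeftChild f v x → LeftChild f v y → x ≡ y
  LeftChild-functional ((_ , s) , e) ((_ , s′) , e′) =
    η-injective (trans (sym s) s′) (trans e (sym e′))

  RightChild-functional : ∀ {v x y} → RightChild f v x → RightChild f v y → x ≡ y
  RightChild-functional (c , e) (c′ , e′) = η-injective (trans c (sym c′)) (trans e (sym e′))

  -- Paths are climbed from the lower end, so that two paths from one vertex can be compared edge by
  -- edge.
  Below : Fin n → Fin n → Set
  Below = Star (flip BinaryChild)

  Below⇒⊐ : ∀ {x v w} → BinaryChild v w → Below x w → _⊏_ f v x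
  Below⇒⊐ c ε       = BinaryChild-⊏ c
  Below⇒⊐ c (d ◅ b) = ⊏-trans f (Below⇒⊐ c b) (BinaryChild-⊏ d)

  Below-comparable : ∀ {x v w} → Below x v → Below x w → Below v w ⊎ Below w v
  Below-comparable ε       b       = inj₁ b
  Below-comparable (c ◅ a) ε       = inj₂ (c ◅ a)
  Below-comparable (c ◅ a) (d ◅ b) with refl ← BinaryChild-injective c d = Below-comparable a b

  -- A nonempty climb from `w` first reaches its only parent `v`, which would put `v` below its own
  -- child `w′`.
  Below-child : ∀ {v w w′} → BinaryChild v w → BinaryChild v w′ → Below w w′ → w ≡ w′
  Below-child c c′ ε       = refl
  Below-child c c′ (d ◅ b) with refl ← BinaryChild-injective c d =
    contradiction (Below⇒⊐ c′ b) (⊏-irrefl f refl)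

  Below-disjoint : ∀ {x v w w′} → LeftChild f v w → RightChild f v w′ →
    Below x w → ¬ Below x w′
  Below-disjoint l r b b′
    with refl ← [ Below-child (inj₁ l) (inj₂ r)
                , sym ∘ Below-child (inj₂ r) (inj₁ l) ]′ (Below-comparable b b′)
    = left≢right l r

  -- Labels of the constructed tree: no repetition, none left out.

  mutual
    -- A relational description of `treeAt`, free of its accessibility argument and of the searches
    -- made by `any?`.
    data TreeOf (v : Fin n) : BinaryTree (Fin n) → Set where
      node : ∀ {l r} → Branch (LeftChild f v) l → Branch (RightChild f v) r →
             TreeOf v (node l v r)

    data Branch (P : Fin n → Set) : BinaryTree (Fin n) → Set where
      absent  : ¬ ∃ P → Branch P empty
      present : ∀ {w t} → P w → TreeOf w t → Branch P t

  graft-branch : ∀ {P : Fin n → Set} d {t : ∀ {x} → P x → BinaryTree (Fin n)} →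
    (∀ {x} (p : P x) → TreeOf x (t p)) → Branch P (graft d t)
  graft-branch (yes (_ , p)) h = present p (h p)
  graft-branch (no ¬p)       h = absent ¬p

  treeAt-treeOf : ∀ v a → TreeOf v (treeAt f v a)
  treeAt-treeOf v (acc rs) = node
    (graft-branch (any? (leftChild? f v))  λ p → treeAt-treeOf _ (rs (left-⊏ f p)))
    (graft-branch (any? (rightChild? f v)) λ p → treeAt-treeOf _ (rs (right-⊏ f p)))

  _∈ᵗ_ : Fin n → BinaryTree (Fin n) → Set
  x ∈ᵗ t = x ∈ labels (walk t)

  ∈ᵗ-left : ∀ {x} l v r → x ∈ᵗ l → x ∈ᵗ node l v r
  ∈ᵗ-left l v r x∈ = there (subst (_ ∈_) (sym (labels-++ (walk l) _)) (∈-++⁺ˡ x∈))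

  ∈ᵗ-right : ∀ {x} l v r → x ∈ᵗ r → x ∈ᵗ node l v r
  ∈ᵗ-right l v r x∈ = there (subst (_ ∈_) (sym (labels-++ (walk l) _)) (∈-++⁺ʳ (labels (walk l)) x∈))

  ∈ᵗ-subtrees : ∀ {x} l r → x ∈ labels (walk l ++ right ∷ walk r) → x ∈ᵗ l ⊎ x ∈ᵗ r
  ∈ᵗ-subtrees l r x∈ = ∈-++⁻ (labels (walk l)) (subst (_ ∈_) (labels-++ (walk l) _) x∈)

  mutual
    treeOf-below : ∀ {v t x} → TreeOf v t → x ∈ᵗ t → Below x v
    treeOf-below (node L R) (here refl) = ε
    treeOf-below (node {l} {r} L R) (there x∈) with ∈ᵗ-subtrees l r x∈
    ... | inj₁ x∈l = let _ , c , b = branch-below L x∈l in b ◅◅ inj₁ c ◅ ε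
    ... | inj₂ x∈r = let _ , c , b = branch-below R x∈r in b ◅◅ inj₂ c ◅ ε

    branch-below : ∀ {P t x} → Branch P t → x ∈ᵗ t → ∃[ w ] P w × Below x w
    branch-below (absent _)    ()
    branch-below (present p T) x∈ = _ , p , treeOf-below T x∈

  mutual
    -- The root strictly precedes its proper descendants in `⊏`, and the two subtrees are disjoint.
    treeOf-unique : ∀ {v t} → TreeOf v t → Unique (labels (walk t))
    treeOf-unique {v} (node {l} {r} L R) = All.tabulate v≢ ∷
      subst Unique (sym (labels-++ (walk l) _)) (++⁺ (branch-unique L) (branch-unique R) disjoint)
      where
      v≢ : ∀ {x} → x ∈ labels (walk l ++ right ∷ walk r) → v ≢ x
      v≢ x∈ with ∈ᵗ-subtrees l r x∈
      ... | inj₁ x∈l = let _ , c , b = branch-below L x∈l in λ { refl → ⊏-irrefl f refl (Below⇒⊐ (inj₁ c) b) }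
      ... | inj₂ x∈r = let _ , c , b = branch-below R x∈r in λ { refl → ⊏-irrefl f refl (Below⇒⊐ (inj₂ c) b) }
      disjoint : ∀ {x} → ¬ (x ∈ᵗ l × x ∈ᵗ r)
      disjoint (x∈l , x∈r) =
        let _ , c , b = branch-below L x∈l ; _ , c′ , b′ = branch-below R x∈r
        in Below-disjoint c c′ b b′

    branch-unique : ∀ {P t} → Branch P t → Unique (labels (walk t))
    branch-unique (absent _)    = []
    branch-unique (present _ T) = treeOf-unique T

  treeOf-root : ∀ {v t} → TreeOf v t → v ∈ᵗ t
  treeOf-root (node _ _) = here refl

  branch-root : ∀ {P t x} → (∀ {y z} → P y → P z → y ≡ z) → Branch P t → P x → x ∈ᵗ t
  branch-root functional (absent ¬p)   q = contradiction (_ , q) ¬p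
  branch-root functional (present p T) q with refl ← functional p q = treeOf-root T

  mutual
    treeOf-closed : ∀ {v t x y} → TreeOf v t → BinaryChild y x → y ∈ᵗ t → x ∈ᵗ t
    treeOf-closed {v} (node {l} {r} L R) (inj₁ c) (here refl) =
      ∈ᵗ-left l v r (branch-root LeftChild-functional L c)
    treeOf-closed {v} (node {l} {r} L R) (inj₂ c) (here refl) =
      ∈ᵗ-right l v r (branch-root RightChild-functional R c)
    treeOf-closed {v} (node {l} {r} L R) c (there y∈) with ∈ᵗ-subtrees l r y∈
    ... | inj₁ y∈l = ∈ᵗ-left l v r (branch-closed L c y∈l)
    ... | inj₂ y∈r = ∈ᵗ-right l v r (branch-closed R c y∈r)

    branch-closed : ∀ {P t x y} → Branch P t → BinaryChild y x → y ∈ᵗ t → x ∈ᵗ t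
    branch-closed (present _ T) c y∈ = treeOf-closed T c y∈

  -- At rank 1 the forest parent, if any, serves; at higher rank the preceding sibling does.
  binary-parent : ∀ x → FirstRoot f x ⊎ ∃[ v ] BinaryChild v x
  binary-parent x = go (η f x) (parent x) refl refl
    where
    go : ∀ m p → η f x ≡ m → parent x ≡ p → FirstRoot f x ⊎ ∃[ v ] BinaryChild v x
    go zero          _        eq _   = contradiction eq (η≢0 x)
    go (suc zero)    nothing  eq eqᵖ = inj₁ (eqᵖ , eq)
    go (suc zero)    (just u) eq eqᵖ = inj₂ (u , inj₂ (eqᵖ , eq))
    go (suc (suc m)) _        eq _   =
      let w , same , eq′ = η-pred x eq
      in inj₂ (w , inj₁ (((λ w≡x → ℕ.1+n≢n (trans (sym eq) (trans (cong (η f) (sym w≡x)) eq′))) , same) ,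
                         trans eq (cong suc (sym eq′))))

  FirstRoot-unique : ∀ {r r′} → FirstRoot f r → FirstRoot f r′ → r ≡ r′
  FirstRoot-unique (a , b) (c , d) = η-injective (trans a (sym c)) (trans b (sym d))

  -- Climbing by `binary-parent` ends at the first root, and `treeOf-closed` carries membership back
  -- down.
  treeOf-complete : ∀ {r t} → FirstRoot f r → TreeOf r t → ∀ x → x ∈ᵗ t
  treeOf-complete {r} {t} root T x = go x (spo-wellFounded (⊏-isStrictPartialOrder f) x)
    where
    go : ∀ x → Acc (_⊏_ f) x → x ∈ᵗ t
    go x (acc rs) with binary-parent x
    ... | inj₁ root′   = subst (_∈ᵗ t) (FirstRoot-unique root root′) (treeOf-root T)
    ... | inj₂ (v , c) = treeOf-closed T c (go v (rs (BinaryChild-⊏ c)))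

  first-root : Fin n → ∃ (FirstRoot f)
  first-root x = go x (spo-wellFounded (⊏-isStrictPartialOrder f) x)
    where
    go : ∀ x → Acc (_⊏_ f) x → ∃ (FirstRoot f)
    go x (acc rs) with binary-parent x
    ... | inj₁ root    = x , root
    ... | inj₂ (v , c) = go v (rs (BinaryChild-⊏ c))

  binaryTree-treeOf : Fin n → ∃[ r ] FirstRoot f r × TreeOf r (binaryTree f)
  binaryTree-treeOf x with any? (firstRoot? f)
  ... | yes (r , root) = r , root , treeAt-treeOf r _
  ... | no none        = contradiction (first-root x) none

  -- The path `P_f` and the end of the word.

  ParentOf : Fin n → Fin n → Set
  ParentOf = flip (_IsChildOf_ f)

  -- `IsFirstPath` from an arbitrary start `v` instead of a root, which permits recursion along the
  -- path.
  record DescendsTo (v : Fin n) (ps : List (Fin n)) (u : Fin n) : Set where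
    constructor descent
    field
      steps : Linked ParentOf (v ∷ ps)
      ends  : last (v ∷ ps) ≡ just u × IsLeaf f u
      first : All (λ x → η f x ≡ 1) (v ∷ ps)

  DescendsTo-unique : ∀ {v ps u ps′ u′} →
    DescendsTo v ps u → DescendsTo v ps′ u′ → ps ≡ ps′
  DescendsTo-unique {ps = []} {ps′ = []} d e = refl
  DescendsTo-unique {ps = []} {ps′ = _ ∷ _} (descent _ (refl , leaf) _) (descent (c ∷ _) _ _) =
    contradiction (_ , c) leaf
  DescendsTo-unique {ps = _ ∷ _} {ps′ = []} (descent (c ∷ _) _ _) (descent _ (refl , leaf) _) =
    contradiction (_ , c) leaf
  DescendsTo-unique {ps = y ∷ _} {ps′ = y′ ∷ _}
    (descent (c ∷ l) e (_ ∷ a@(i ∷ _))) (descent (c′ ∷ l′) e′ (_ ∷ a′@(i′ ∷ _)))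
    with refl ← RightChild-functional (c , i) (c′ , i′) =
    cong (y ∷_) (DescendsTo-unique (descent l e a) (descent l′ e′ a′))

  -- `w` is the word of the right spine `ps`; in `broken`, `x` is the last spine vertex with a
  -- sibling.
  data Tail (ps : List (Fin n)) (w : List (Step n)) : Set where
    unbroken : All (¬_ ∘ HasSibling) ps → w ≡ chain ps → Tail ps w
    broken   : ∀ q x us w′ → HasSibling x → All (¬_ ∘ HasSibling) us →
               ps ≡ q ++ x ∷ us → w ≡ w′ ++ right ∷ right ∷ chain us → Tail ps w

  tail-∷ : ∀ {v l ps w} → η f v ≡ 1 → Branch (LeftChild f v) l → Tail ps w →
    Tail (v ∷ ps) (up v ∷ walk l ++ right ∷ w)
  tail-∷ {v} first (absent none) (unbroken lone refl) =
    unbroken (first-without-next first none ∷ lone) refl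
  -- An existing break stays in place: everything recorded for `v` goes into the prefixes `q` and
  -- `w′`.
  tail-∷ {v} first (absent none) (broken q x us w′ sib lone refl refl) =
    broken (v ∷ q) x us (up v ∷ right ∷ w′) sib lone refl refl
  tail-∷ {v} {l} first (present _ _) (broken q x us w′ sib lone refl refl) =
    broken (v ∷ q) x us (up v ∷ walk l ++ right ∷ w′) sib lone refl
      (cong (up v ∷_) (sym (++-assoc (walk l) (right ∷ w′) _)))
  -- Below `v` no spine vertex has a sibling, so `v` is the break; the last right step of its left
  -- subtree meets its own.
  tail-∷ {v} {l} {ps} first (present (sib , _) (node {l′} {r′} _ _)) (unbroken lone refl) =
    let w , eq = walk-ends-right l′ _ r′
    in broken [] v ps (up v ∷ w) (_ , sib) lone refl
         (cong (up v ∷_) (trans (cong (_++ right ∷ chain ps) eq) (++-assoc w (right ∷ []) _)))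

  treeOf-spine : ∀ {v t} → η f v ≡ 1 → TreeOf v t →
    ∃[ ps ] ∃[ u ] DescendsTo v ps u × Tail (v ∷ ps) (walk t)
  treeOf-spine {v} first (node L (absent none)) =
    [] , v , descent [-] (refl , leaf) (first ∷ []) , tail-∷ first L (unbroken [] refl)
    where
    -- Any child of `v` has a sibling, or is itself, of rank 1, and that is a right child.
    leaf : IsLeaf f v
    leaf (c , child) =
      let w , same , first′ = first-sibling c in none (w , trans same child , first′)
  treeOf-spine {v} first (node L (present {w} (child , first′) T)) =
    let ps , u , descent steps ends firsts , tail = treeOf-spine first′ T
    in w ∷ ps , u , descent (child ∷ steps) ends (first ∷ firsts) , tail-∷ first L tail

  -- Longest admissible sub-paths.

  Admitted : Fin n → Set
  Admitted x = ¬ IsRoot f x × ¬ HasSibling x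

  linked-nonRoot : ∀ q {x us} → Linked ParentOf (q ++ x ∷ us) →
    All (λ y → ¬ IsRoot f y) us
  linked-nonRoot []      [-]     = []
  linked-nonRoot []      (c ∷ l) =
    (λ root → contradiction (trans (sym c) root) λ ()) ∷ linked-nonRoot [] l
  linked-nonRoot (_ ∷ q) l       = linked-nonRoot q (Linked.tail l)

  -- A vertex with a successor on the path has a child, so the leaf is last and `t` is a suffix.
  leaf-last : ∀ pre {t v} rest → Linked ParentOf (pre ++ t ++ rest) →
    v ∈ t → IsLeaf f v → rest ≡ []
  leaf-last (_ ∷ pre) rest l v∈ leaf = leaf-last pre rest (Linked.tail l) v∈ leaf
  leaf-last [] {t = _ ∷ []} [] l (here refl) leaf = refl
  leaf-last [] {t = _ ∷ []} (_ ∷ _) (c ∷ _) (here refl) leaf = contradiction (_ , c) leaf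
  leaf-last [] {t = _ ∷ _ ∷ _} rest (c ∷ _) (here refl) leaf = contradiction (_ , c) leaf
  leaf-last [] {t = _ ∷ _} rest l (there v∈) leaf = leaf-last [] rest (Linked.tail l) v∈ leaf

  module _ {q x us v} (linked : Linked ParentOf (q ++ x ∷ us))
    (end : last (q ++ x ∷ us) ≡ just v) (leaf : IsLeaf f v)
    (stop : ¬ Admitted x) (lone : All (¬_ ∘ HasSibling) us) where

    -- An admissible `t` is a suffix avoiding `x`, so it starts after `x`.
    admissible-length : ∀ {t} → Admissible f (q ++ x ∷ us) v t → length t ≤ length us
    admissible-length {t} A =
      let pre , rest , eq = infix-split subPath
          rest≡[] = leaf-last pre rest (subst (Linked _) eq linked) contains leaf
          split = trans (cong (pre ++_) (sym (++-identityʳ t)))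
                        (trans (cong (λ z → pre ++ t ++ z) (sym rest≡[])) (sym eq))
      in suffix-length pre q split
           (λ x∈ → stop (All.lookup noRoot x∈ , All.lookup noSiblings x∈))
      where open Admissible A

    tail-admissible : us ≢ [] → Admissible f (q ++ x ∷ us) v us
    tail-admissible us≢[] = record
      { subPath    = q ++ⁱ there (fromPointwise (Pointwise.refl refl))
      ; contains   = v∈ us≢[] end
      ; noRoot     = linked-nonRoot q linked
      ; noSiblings = lone
      }
      where
      v∈ : ∀ {us} → us ≢ [] → last (q ++ x ∷ us) ≡ just v → v ∈ us
      v∈ {[]}     us≢[] _   = contradiction refl us≢[]
      v∈ {y ∷ ys} _     end = last-∈ (y ∷ ys) (trans (sym (last-++ q)) end)

    -- Containing `v` forces positive length, while the bound is now 0.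
    none-admissible : us ≡ [] → ∀ t → ¬ Admissible f (q ++ x ∷ us) v t
    none-admissible refl t A with t | Admissible.contains A | admissible-length A
    ... | _ ∷ _ | _ | ()

    tail-longest : IsLongestAdmissible f (q ++ x ∷ us) v us
    tail-longest with List.≡-dec Fin._≟_ us []
    ... | yes us≡[] = inj₂ (us≡[] , none-admissible us≡[])
    ... | no  us≢[] = inj₁ (tail-admissible us≢[] , λ _ → admissible-length)

    longest-length : ∀ {s} → IsLongestAdmissible f (q ++ x ∷ us) v s → length s ≡ length us
    longest-length (inj₁ (A , longest)) with List.≡-dec Fin._≟_ us []
    ... | yes us≡[] = contradiction A (none-admissible us≡[] _)
    ... | no  us≢[] = ℕ.≤-antisym (admissible-length A) (longest us (tail-admissible us≢[]))
    longest-length (inj₂ (refl , none)) with List.≡-dec Fin._≟_ us []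
    ... | yes us≡[] = cong length (sym us≡[])
    ... | no  us≢[] = contradiction (tail-admissible us≢[]) (none us)

  -- x is the last vertex of P_f that is a root or has a sibling, and k₀ is the
  -- unique index with f ∈ RF_{n,k₀}.
  record Shape : Set where
    field
      {r u x}   : Fin n
      {ps q us} : List (Fin n)
      k₀        : ℕ
      root      : FirstRoot f r
      descends  : DescendsTo r ps u
      split     : r ∷ ps ≡ q ++ x ∷ us
      stop      : ¬ Admitted x
      lone      : All (¬_ ∘ HasSibling) us
      total     : k₀ + length us ≡ n
      class     : ∀ k → RF[ k ] f ⇔ k ≡ k₀

  shape : Fin n → Shape
  shape v with r , root@(isRoot , first) , T ← binaryTree-treeOf v
    with treeOf-spine first T
       | treeOf-unique T | treeOf-complete root T
       | walk-ballot {d = 0} (binaryTree f) []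
       | rights-walk (binaryTree f)
  -- Without siblings on the spine, the root `r` stops the sub-path, and `us` is all of `ps`.
  ... | ps , u , d , unbroken (_ ∷ lone) eq | uniq | complete | _ | _ = record
    { k₀ = 1
    ; root = root
    ; descends = d
    ; q = []
    ; split = refl
    ; stop = λ (nonRoot , _) → nonRoot isRoot
    ; lone = lone
    ; total = Enumeration.length≡ uniq′ complete′
    ; class = λ k → Class-permutation (subst (IsPermutationOf1⋯n ∘ tuple) (sym eq)
                      (tuple-chain-isPermutation uniq′ complete′))
    }
    where
    labels≡ : labels (walk (binaryTree f)) ≡ r ∷ ps
    labels≡ = trans (cong labels eq) (labels-chain (r ∷ ps))
    uniq′ = subst Unique labels≡ uniq
    complete′ = λ i → subst (i ∈_) labels≡ (complete i)
  -- The tuple adds 1 to the skipped count `suc (rights w)`, hence `2 + rights w`.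
  ... | ps , u , d , broken q x us w sib lone split eq | uniq | complete | ballot | rights≡ = record
    { k₀ = 2 + rights w
    ; root = root
    ; descends = d
    ; split = split
    ; stop = λ (_ , noSib) → noSib sib
    ; lone = lone
    ; total = total
    ; class = λ k → Class-missing (s≤s (s≤s z≤n))
        (subst (2 + rights w ≤_) total (ℕ.m≤m+n _ (length us)))
        ( tuple-isParkingFunction (subst (Ballot 0) (++-identityʳ _) ballot) uniq complete
        , subst (λ z → ¬ (∃[ i ] tuple z i ≡ 2 + rights w)) (sym eq)
            (λ (i , eq′) → rightsBefore-gap i w (chain us) (ℕ.suc-injective eq′))
        , λ j lo hi → subst (λ z → ∃[ i ] tuple z i ≡ j) (sym eq)
            (tuple-tail w us (subst Unique labels≡ uniq) j lo
              (ℕ.≤-trans hi (ℕ.≤-reflexive (sym total)))))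
    }
    where
    open ≡-Reasoning
    labels≡ : labels (walk (binaryTree f)) ≡ labels w ++ us
    labels≡ = trans (cong labels eq)
      (trans (labels-++ w _) (cong (labels w ++_) (labels-chain us)))
    -- Both sides count the right steps of the whole word, one per vertex.
    total : 2 + rights w + length us ≡ n
    total = begin
      2 + rights w + length us                    ≡⟨ cong (2 + rights w +_) (rights-chain us) ⟨
      2 + rights w + rights (chain us)
        ≡⟨ cong suc (ℕ.+-suc (rights w) (rights (chain us))) ⟨
      suc (rights w + suc (rights (chain us)))    ≡⟨ ℕ.+-suc (rights w) _ ⟨
      rights w + (2 + rights (chain us))          ≡⟨ rights-++ w (right ∷ right ∷ chain us) ⟨
      rights (w ++ right ∷ right ∷ chain us)      ≡⟨ cong rights eq ⟨
      rights (walk (binaryTree f))                ≡⟨ rights≡ ⟩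
      length (labels (walk (binaryTree f)))       ≡⟨ Enumeration.length≡ uniq complete ⟩
      n                                           ∎

  -- From the index to the length of the sub-path.

  module _ (S : Shape) where
    open Shape S

    path-unique : ∀ {p v} → IsFirstPath f p v → p ≡ r ∷ ps
    path-unique {[]}     record { starts = _ , () , _ }
    path-unique {_ ∷ qs} record { starts = _ , refl , isRoot ; steps = steps ; ends = ends ; first = first }
      with refl ← FirstRoot-unique (isRoot , All.head first) root =
      cong (r ∷_) (DescendsTo-unique (descent steps ends first) descends)

    longest-size : ∀ m → LongestSubPathHasSize f m ⇔ m ≡ length us
    longest-size m = mk⇔ to from
      where
      to : LongestSubPathHasSize f m → m ≡ length us
      to (p , v , s , path , longest , refl) with refl ← trans (path-unique path) split =
        longest-length (IsFirstPath.steps path) (proj₁ (IsFirstPath.ends path))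
          (proj₂ (IsFirstPath.ends path)) stop lone longest
      from : m ≡ length us → LongestSubPathHasSize f m
      from refl = r ∷ ps , u , us ,
        record { starts = r , refl , proj₁ root ; steps = steps ; ends = ends ; first = first } ,
        subst (λ p → IsLongestAdmissible f p u us) (sym split)
          (tail-longest (subst (Linked _) split steps) (trans (cong last (sym split)) (proj₁ ends))
            (proj₂ ends) stop lone) ,
        refl
        where open DescendsTo descends

    size-class : ∀ {k} → k ≤ n → k ≡ k₀ ⇔ n ∸ k ≡ length us
    size-class {k} k≤n = mk⇔ (λ { refl → n∸k₀ })
      -- Truncated subtraction cancels because both `k` and `k₀` are at most `n`.
      (λ eq → ∸-cancelˡ-≡ k≤n (subst (k₀ ≤_) total (ℕ.m≤m+n k₀ _)) (trans eq (sym n∸k₀)))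
      where
      n∸k₀ : n ∸ k₀ ≡ length us
      n∸k₀ = trans (cong (_∸ k₀) (sym total)) (ℕ.m+n∸m≡n k₀ _)

theorem4p13 : ∀ (n k : ℕ) → 1 ≤ n → 1 ≤ k → k ≤ n → (f : RootedForest n) →
    RF[ k ] f ⇔ LongestSubPathHasSize f (n ∸ k)
theorem4p13 n k 1≤n _ k≤n f =
  -- Read from right to left: `k ≡ k₀`, then `n ∸ k ≡ length us`, then the sub-path. The vertex
  -- given by `1 ≤ n` witnesses that the forest is nonempty.
  ⇔-sym (longest-size f S (n ∸ k)) ⇔-∘ (size-class f S k≤n ⇔-∘ Shape.class S k)
  where S = shape f (fromℕ< 1≤n)
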